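{- Let $T$ be a tree on $n$ vertices and let $\Delta(T)$ denote its maximum degree. Then $$\gamma_g(T) \ge \left\lceil \frac{2n}{\Delta(T)+3} \right\rceil - 1 .$$
   Context: Graphs are finite, simple and nonempty. For a vertex $v$, $N[v]$ is its closed neighborhood; a chosen vertex $v$ dominates all vertices of $N[v]$. The domination game on a graph $G$ is played by two players, Dominator and Staller, who alternately choose vertices of $G$; each chosen vertex must dominate at least one vertex that was not dominated by the previously chosen vertices. The game ends when all vertices of $G$ are dominated. Dominator wants the total number of chosen vertices to be as small as possible, Staller wants it to be as large as possible. The game domination number $\gamma_g(G)$ is the total number of vertices chosen (by both players) when Dominator makes the first move and both players play optimally. -}

module Defs where

open import Data.Fin using (Fin)
open import Data.Fin.Properties using (any?)
open import Data.Fin.Subset using (Subset; ⊥; ⁅_⁆; ∣_∣; _∈_; _∉_; _∪_; _⊂_; _⊃_)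
open import Data.Fin.Subset.Induction using (⊃-wellFounded)
open import Data.Fin.Subset.Properties using (_∈?_; p⊆p∪q; q⊆p∪q)
open import Data.List using (List; []; _∷_; _∷ʳ_; length; map; mapMaybe; allFin)
open import Data.List.Extrema.Nat using (min; max)
open import Data.List.Relation.Unary.Linked using (Linked)
open import Data.List.Relation.Unary.Unique.Propositional using (Unique)
import Data.Maybe as Maybe
open import Data.Nat using (ℕ; suc; _≤_)
open import Data.Product using (∃; _×_; _,_)
open import Data.Vec using (tabulate)
open import Function using (_∘_)
open import Induction.WellFounded using (Acc; acc)
open import Level using (0ℓ)
open import Relation.Binary using (Rel; Decidable; Symmetric; Irreflexive)
open import Relation.Binary.Construct.Closure.ReflexiveTransitive using (Star)
open import Relation.Binary.PropositionalEquality using (_≡_)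
open import Relation.Nullary using (Dec; ¬_; ¬?; does; _×-dec_)
open import Relation.Nullary.Decidable using (dec⇒maybe)

record Graph (n : ℕ) : Set₁ where
  infix 4 _~_ _~?_
  field
    _~_      : Rel (Fin n) 0ℓ
    _~?_     : Decidable _~_
    ~-sym    : Symmetric _~_
    ~-irrefl : Irreflexive _≡_ _~_

module _ {n : ℕ} (G : Graph n) where
  open Graph G

  N : Fin n → Subset n
  N v = tabulate (does ∘ (v ~?_))

  N[_] : Fin n → Subset n
  N[ v ] = ⁅ v ⁆ ∪ N v

  degree : Fin n → ℕ
  degree v = ∣ N v ∣

  maxDegree : ℕ
  maxDegree = max 0 (map degree (allFin n))

  Connected : Set
  Connected = ∀ u v → Star _~_ u v

  -- The cycle v, v₁, …, vₖ, v with vs = v₁, …, vₖ; the bound on the length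
  -- excludes walking back and forth along a single edge.
  record IsCycle (v : Fin n) (vs : List (Fin n)) : Set where
    field
      long     : 2 ≤ length vs
      distinct : Unique (v ∷ vs)
      closed   : Linked _~_ (v ∷ (vs ∷ʳ v))

  Acyclic : Set
  Acyclic = ∀ v vs → ¬ IsCycle v vs

  record IsTree : Set where
    field
      connected : Connected
      acyclic   : Acyclic

data Player : Set where
  dominator staller : Player

opponent : Player → Player
opponent dominator = staller
opponent staller   = dominator

-- The value 0 on the empty list is the length of a game that is already over.
optimum : Player → List ℕ → ℕ
optimum _         []       = 0
optimum dominator (k ∷ ks) = min k ks
optimum staller   (k ∷ ks) = max k ks

-- A position of the game is the set D of vertices dominated so far.
module _ {n : ℕ} (G : Graph n) where

  Legal : Subset n → Fin n → Set
  Legal D v = ∃ λ u → u ∈ N[_] G v × u ∉ D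

  legal? : ∀ D v → Dec (Legal D v)
  legal? D v = any? λ u → (u ∈? N[_] G v) ×-dec ¬? (u ∈? D)

  -- An undominated vertex is itself a legal move, so this list is empty
  -- exactly when all vertices are dominated.
  legalMoves : ∀ D → List (∃ (Legal D))
  legalMoves D = mapMaybe (λ v → Maybe.map (v ,_) (dec⇒maybe (legal? D v))) (allFin n)

  legal⇒⊂ : ∀ {D v} → Legal D v → D ⊂ D ∪ N[_] G v
  legal⇒⊂ {D} {v} (u , u∈N[v] , u∉D) =
    p⊆p∪q (N[_] G v) , u , q⊆p∪q D (N[_] G v) u∈N[v] , u∉D

  -- The number of moves still to be made from D under optimal play when p is
  -- to move. Every move enlarges D, so the recursion is well founded.
  movesLeft : Player → (D : Subset n) → Acc _⊃_ D → ℕ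
  movesLeft p D (acc rs) = optimum p (map
    (λ (v , legal) → suc (movesLeft (opponent p) (D ∪ N[_] G v) (rs (legal⇒⊂ legal))))
    (legalMoves D))

  γg : ℕ
  γg = movesLeft dominator ⊥ (⊃-wellFounded ⊥)

{-# OPTIONS --safe #-}
-- On his turn, Staller can always play a vertex that dominates at most two new
-- vertices: the undominated vertices induce a forest, and he plays a vertex of
-- degree at most one in it.  Dominator's moves dominate at most Δ + 1 new
-- vertices each, so two consecutive moves dominate at most Δ + 3 vertices.
module Submission where

open import Defs
open import Data.Integer using (+_; _-_; _≤_; 1ℤ)
open import Data.Nat using (ℕ; NonZero; _+_; _*_)
open import Data.Rational.Unnormalised using (_/_; ceiling)

open import Data.Fin using (Fin)
open import Data.Fin.Properties using (_≟_; any?)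
open import Data.Fin.Subset
  using (Subset; inside; outside; ⊥; ∁; ⁅_⁆; ∣_∣; _∈_; _⊆_; _⊃_; _∪_; _∩_; Nonempty)
open import Data.Fin.Subset.Induction using (⊃-wellFounded)
open import Data.Fin.Subset.Properties
open import Data.Integer using (-_)
import Data.Integer as ℤ
import Data.Integer.DivMod as ℤ
import Data.Integer.Properties as ℤ
open import Data.List using (List; []; _∷_; [_]; _++_; _∷ʳ_; length; allFin)
open import Data.List.Extrema.Nat using (argmin-all; ⊥≤max; xs≤max)
open import Data.List.Membership.Propositional using (find; lose) renaming (_∈_ to _∈ₗ_)
open import Data.List.Membership.Propositional.Properties using (∈-map⁺; ∈-allFin; ∈-∃++)
open import Data.List.Properties using (++-assoc)
open import Data.List.Relation.Unary.All using (All; []; _∷_)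
import Data.List.Relation.Unary.All as All
import Data.List.Relation.Unary.All.Properties as All
open import Data.List.Relation.Unary.AllPairs using ([]; _∷_)
open import Data.List.Relation.Unary.Any using (Any; here; there)
import Data.List.Relation.Unary.Any as Any
import Data.List.Relation.Unary.Any.Properties as Any
open import Data.List.Relation.Unary.Linked using (Linked; [-]; _∷_)
open import Data.List.Relation.Unary.Unique.Propositional using (Unique)
import Data.Maybe as Maybe
import Data.Maybe.Relation.Unary.Any as MaybeAny
import Data.Nat as ℕ
import Data.Nat.Properties as ℕ
open import Data.Nat.Tactic.RingSolver using (solve-∀)
open import Data.Product using (∃; _×_; _,_; proj₁)
open import Data.Sum using (inj₁; inj₂; [_,_]′)
open import Data.Vec using ([]; _∷_)
open import Data.Vec.Properties using (lookup∘tabulate; []=⇒lookup)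
open import Function using (_∘_; id)
open import Induction.WellFounded using (Acc; acc)
open import Relation.Binary using (Rel)
open import Relation.Binary.PropositionalEquality
  using (_≡_; _≢_; refl; sym; trans; cong; subst)
open import Relation.Nullary using (Dec; yes; no; ¬?; _×-dec_; contradiction)
open import Relation.Nullary.Decidable using (dec⇒maybe)

-- Cardinalities of finite subsets.

∣p∪q∣≤∣p∣+∣q∣ : ∀ {n} (p q : Subset n) → ∣ p ∪ q ∣ ℕ.≤ ∣ p ∣ + ∣ q ∣
∣p∪q∣≤∣p∣+∣q∣ []            []            = ℕ.z≤n
∣p∪q∣≤∣p∣+∣q∣ (outside ∷ p) (outside ∷ q) = ∣p∪q∣≤∣p∣+∣q∣ p q
∣p∪q∣≤∣p∣+∣q∣ (outside ∷ p) (inside  ∷ q) =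
  subst (ℕ.suc ∣ p ∪ q ∣ ℕ.≤_) (sym (ℕ.+-suc ∣ p ∣ ∣ q ∣)) (ℕ.s≤s (∣p∪q∣≤∣p∣+∣q∣ p q))
∣p∪q∣≤∣p∣+∣q∣ (inside  ∷ p) (t ∷ q)       =
  ℕ.s≤s (ℕ.≤-trans (∣p∪q∣≤∣p∣+∣q∣ p q) (ℕ.+-monoʳ-≤ ∣ p ∣ (∣p∣≤∣x∷p∣ t q)))

-- A vertex outside `p` either stays outside `p ∪ q` or lies in `q`. With `p` the dominated set and
-- `q` a closed neighborhood, a move costs only its newly dominated vertices.
∣∁p∣≤∣∁[p∪q]∣+∣q∩∁p∣ : ∀ {n} (p q : Subset n) → ∣ ∁ p ∣ ℕ.≤ ∣ ∁ (p ∪ q) ∣ + ∣ q ∩ ∁ p ∣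
∣∁p∣≤∣∁[p∪q]∣+∣q∩∁p∣ p q = ℕ.≤-trans (p⊆q⇒∣p∣≤∣q∣ cover) (∣p∪q∣≤∣p∣+∣q∣ (∁ (p ∪ q)) (q ∩ ∁ p))
  where
  cover : ∁ p ⊆ ∁ (p ∪ q) ∪ (q ∩ ∁ p)
  cover {x} x∈∁p with x ∈? q
  ... | yes x∈q = x∈p∪q⁺ (inj₂ (x∈p∩q⁺ (x∈q , x∈∁p)))
  ... | no  x∉q = x∈p∪q⁺ (inj₁ (x∉p⇒x∈∁p ([ x∈∁p⇒x∉p x∈∁p , x∉q ]′ ∘ x∈p∪q⁻ p q)))

-- Otherwise `p` would lie inside `⁅ x ⁆`. On a path this supplies a neighbor other than the
-- predecessor.
1<∣p∣⇒∃≢ : ∀ {n} {p : Subset n} → 1 ℕ.< ∣ p ∣ → ∀ x → ∃ λ y → y ∈ p × y ≢ x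
1<∣p∣⇒∃≢ {p = p} 1<∣p∣ x with any? (λ y → (y ∈? p) ×-dec ¬? (y ≟ x))
... | yes found = found
... | no  none  = contradiction (subst (∣ p ∣ ℕ.≤_) (∣⁅x⁆∣≡1 x) (p⊆q⇒∣p∣≤∣q∣ p⊆⁅x⁆)) (ℕ.<⇒≱ 1<∣p∣)
  where
  p⊆⁅x⁆ : p ⊆ ⁅ x ⁆
  p⊆⁅x⁆ {y} y∈p with y ≟ x
  ... | yes refl = x∈⁅x⁆ x
  ... | no  y≢x  = contradiction (y , y∈p , y≢x) none

-- Cutting and closing paths written as lists.

module _ {a} {A : Set a} where

  Unique-++⁻ˡ : ∀ (xs : List A) {ys} → Unique (xs ++ ys) → Unique xs
  Unique-++⁻ˡ []       _          = []
  Unique-++⁻ˡ (x ∷ xs) (x∉ ∷ xs!) = All.++⁻ˡ xs x∉ ∷ Unique-++⁻ˡ xs xs!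

  Linked-close : ∀ {ℓ} {R : Rel A ℓ} {x w v} ys {zs} →
    Linked R (x ∷ ys ++ w ∷ zs) → R w v → Linked R (x ∷ (ys ++ [ w ]) ∷ʳ v)
  Linked-close []       (Rxw ∷ _)   Rwv = Rxw ∷ Rwv ∷ [-]
  Linked-close (y ∷ ys) (Rxy ∷ Rys) Rwv = Rxy ∷ Linked-close ys Rys Rwv

-- Neighborhoods, and leaves of induced forests.

module _ {n} (G : Graph n) where
  open Graph G

  ∈N⇒~ : ∀ {u v} → u ∈ N G v → v ~ u
  -- For `no` the equation would read `outside ≡ inside`, so only `yes` remains.
  ∈N⇒~ {u} {v} u∈N with v ~? u | trans (sym (lookup∘tabulate _ u)) ([]=⇒lookup u∈N)
  ... | yes v~u | _ = v~u

  v∈N[v] : ∀ v → v ∈ N[_] G v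
  v∈N[v] v = x∈p∪q⁺ (inj₁ (x∈⁅x⁆ v))

  ∣N[v]∣≤1+maxDegree : ∀ v → ∣ N[_] G v ∣ ℕ.≤ 1 + maxDegree G
  ∣N[v]∣≤1+maxDegree v = begin
    ∣ N[_] G v ∣          ≤⟨ ∣p∪q∣≤∣p∣+∣q∣ ⁅ v ⁆ (N G v) ⟩
    ∣ ⁅ v ⁆ ∣ + degree G v ≡⟨ cong (_+ degree G v) (∣⁅x⁆∣≡1 v) ⟩
    1 + degree G v        ≤⟨ ℕ.+-monoʳ-≤ 1 (All.lookup (xs≤max 0 _) (∈-map⁺ (degree G) (∈-allFin v))) ⟩
    1 + maxDegree G       ∎
    where open ℕ.≤-Reasoning

  -- The newest end `v` of the path is its head. Cutting the list just after `w` leaves the segment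
  -- from `v` to `w`, and the edge back to `v` closes it. Since `w` comes after `p`, at least two
  -- vertices besides `v` remain, as `long` demands.
  chord⇒cycle : ∀ {v p w ps} → Unique (v ∷ p ∷ ps) → Linked _~_ (v ∷ p ∷ ps) →
    w ∈ₗ ps → w ~ v → ∃ (IsCycle G v)
  chord⇒cycle {v} {p} {w} path! path w∈ps w~v with ∈-∃++ w∈ps
  ... | ys , zs , refl = p ∷ ys ++ [ w ] , record
    { long     = ℕ.s≤s (nonempty ys)
    ; distinct = Unique-++⁻ˡ (v ∷ p ∷ ys ++ [ w ])
                   (subst (λ l → Unique (v ∷ p ∷ l)) (sym (++-assoc ys [ w ] zs)) path!)
    ; closed   = Linked-close (p ∷ ys) path w~v
    }
    where
    nonempty : ∀ ys → 1 ℕ.≤ length (ys ++ [ w ])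
    nonempty []      = ℕ.s≤s ℕ.z≤n
    nonempty (_ ∷ _) = ℕ.s≤s ℕ.z≤n

  module _ (acyclic : Acyclic G) (U : Subset n) where

    -- A leaf of the subgraph induced by `U`, isolated vertices included.
    HasLeaf : Set
    HasLeaf = ∃ λ u → u ∈ U × ∣ N G u ∩ U ∣ ℕ.≤ 1

    -- V, a set of path vertices, only serves as the termination measure.
    extendToLeaf : ∀ {V} → Acc _⊃_ V → ∀ {v p ps} →
      (∀ {x} → x ∈ V → x ∈ₗ v ∷ p ∷ ps) →
      Unique (v ∷ p ∷ ps) → Linked _~_ (v ∷ p ∷ ps) → v ∈ U → HasLeaf
    extendToLeaf {V} (acc rs) {v} {p} {ps} V⊆path path! path v∈U
      with ∣ N G v ∩ U ∣ ℕ.≤? 1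
    ... | yes ≤1 = v , v∈U , ≤1
    -- With two neighbors in `U`, some neighbor `w` differs from the predecessor `p`. It either lies
    -- further back on the path, giving a cycle, or prolongs the path.
    ... | no  ≰1
      with w , w∈ , w≢p ← 1<∣p∣⇒∃≢ (ℕ.≰⇒> ≰1) p
      with w∈N , w∈U ← x∈p∩q⁻ (N G v) U w∈
      with Any.any? (w ≟_) (v ∷ p ∷ ps)
    ... | yes (here refl)          = contradiction (∈N⇒~ w∈N) (~-irrefl refl)
    ... | yes (there (here w≡p))   = contradiction w≡p w≢p
    ... | yes (there (there w∈ps)) =
      let vs , isCycle = chord⇒cycle path! path w∈ps (~-sym (∈N⇒~ w∈N))
      in contradiction isCycle (acyclic v vs)
    -- `V` consists of path vertices, so `w` is outside `V` and adding it enlarges `V` strictly.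
    ... | no  w∉path = extendToLeaf
      (rs ( p⊆p∪q ⁅ w ⁆
          , w , x∈p∪q⁺ (inj₂ (x∈⁅x⁆ w)) , w∉path ∘ V⊆path))
      ([ there ∘ V⊆path , here ∘ x∈⁅y⁆⇒x≡y w ]′ ∘ x∈p∪q⁻ V ⁅ w ⁆)
      (All.¬Any⇒All¬ _ w∉path ∷ path!) (~-sym (∈N⇒~ w∈N) ∷ path) w∈U

    -- If `u` is not a leaf itself, an edge from `u` to another vertex of `U` starts a path, which
    -- is prolonged until it ends in a leaf.
    acyclic⇒leaf : Nonempty U → HasLeaf
    acyclic⇒leaf (u , u∈U) with ∣ N G u ∩ U ∣ ℕ.≤? 1
    ... | yes ≤1 = u , u∈U , ≤1
    ... | no  ≰1
      with w , w∈ , w≢u ← 1<∣p∣⇒∃≢ (ℕ.≰⇒> ≰1) u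
      with w∈N , w∈U ← x∈p∩q⁻ (N G u) U w∈ = extendToLeaf (⊃-wellFounded ⊥)
        (λ x∈⊥ → contradiction x∈⊥ ∉⊥)
        ((w≢u ∷ []) ∷ [] ∷ []) (~-sym (∈N⇒~ w∈N) ∷ [-]) w∈U

  leaf⇒∣N[u]∩U∣≤2 : ∀ {U u} → ∣ N G u ∩ U ∣ ℕ.≤ 1 → ∣ N[_] G u ∩ U ∣ ℕ.≤ 2
  leaf⇒∣N[u]∩U∣≤2 {U} {u} ≤1 = begin
    ∣ N[_] G u ∩ U ∣            ≡⟨ cong ∣_∣ (∩-distribʳ-∪ U ⁅ u ⁆ (N G u)) ⟩
    ∣ (⁅ u ⁆ ∩ U) ∪ (N G u ∩ U) ∣ ≤⟨ ∣p∪q∣≤∣p∣+∣q∣ (⁅ u ⁆ ∩ U) (N G u ∩ U) ⟩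
    ∣ ⁅ u ⁆ ∩ U ∣ + ∣ N G u ∩ U ∣ ≤⟨ ℕ.+-mono-≤ (∣p∩q∣≤∣p∣ ⁅ u ⁆ U) ≤1 ⟩
    ∣ ⁅ u ⁆ ∣ + 1               ≡⟨ cong (_+ 1) (∣⁅x⁆∣≡1 u) ⟩
    2                           ∎
    where open ℕ.≤-Reasoning

  -- Only the vertices are compared, since the legality witness found by `legal?` may differ from
  -- the given one.
  legal⇒∈legalMoves : ∀ {D v} → Legal G D v → Any (λ m → proj₁ m ≡ v) (legalMoves G D)
  legal⇒∈legalMoves {D} {v} legal =
    Any.mapMaybe⁺ _ (allFin n) (Any.map⁺ (lose (∈-allFin v) (listed (legal? G D v))))
    where
    listed : (legal? : Dec (Legal G D v)) →
      MaybeAny.Any (λ m → proj₁ m ≡ v) (Maybe.map (v ,_) (dec⇒maybe legal?))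
    listed (yes _)     = MaybeAny.just refl
    listed (no ¬legal) = contradiction legal ¬legal

-- Bounds along optimal play.

optimum-dominator : ∀ {p} {P : ℕ → Set p} {k ks} →
  k ∈ₗ ks → All P ks → P (optimum dominator ks)
-- The membership rules out the empty list, whose default value 0 may fail `P`.
optimum-dominator {ks = _ ∷ _} _ (Pk ∷ Pks) = argmin-all id Pk Pks

≤optimum-staller : ∀ {k ks} → k ∈ₗ ks → k ℕ.≤ optimum staller ks
≤optimum-staller {ks = l ∷ ks} (here refl)  = ⊥≤max l ks
≤optimum-staller {ks = l ∷ ks} (there k∈ks) = All.lookup (xs≤max l ks) k∈ks

module _ {n} (G : Graph n) (acyclic : Acyclic G) where

  private
    c = 3 + maxDegree G

  -- Chosen so that the bound below survives a move of either player:
  -- 2 (Δ + 1) + 4 = c + c when Dominator moves, 2 · 2 + c = c + 4 when Staller does.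
  slack : Player → ℕ
  slack dominator = c
  slack staller   = 4

  -- Induction along the game. All moves of Dominator must be checked, as he takes a minimum; for
  -- Staller one good move suffices, as he takes a maximum.
  undominated≤movesLeft : ∀ p D (a : Acc _⊃_ D) →
    2 * ∣ ∁ D ∣ ℕ.≤ movesLeft G p D a * c + slack p
  undominated≤movesLeft p D (acc rs) with nonempty? (∁ D)
  ... | no empty = ℕ.≤-trans (ℕ.≤-reflexive (cong (2 *_) ∣∁D∣≡0)) ℕ.z≤n
    where
    ∣∁D∣≡0 : ∣ ∁ D ∣ ≡ 0
    ∣∁D∣≡0 = trans (cong ∣_∣ (Empty-unique empty)) (∣⊥∣≡0 n)
  undominated≤movesLeft dominator D (acc rs) | yes (u , u∈∁D) =
    -- The undominated `u` is a legal move itself, so the list of moves is not empty.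
    let m , m∈ , _ = find (legal⇒∈legalMoves G (u , v∈N[v] G u , x∈∁p⇒x∉p u∈∁D))
    in optimum-dominator {P = λ k → 2 * ∣ ∁ D ∣ ℕ.≤ k * c + c}
         (∈-map⁺ _ m∈) (All.map⁺ (All.universal afterMove (legalMoves G D)))
    where
    afterMove : ((v , legal) : ∃ (Legal G D)) → 2 * ∣ ∁ D ∣ ℕ.≤
      ℕ.suc (movesLeft G staller (D ∪ N[_] G v) (rs (legal⇒⊂ G legal))) * c + c
    afterMove (v , legal) = begin
      2 * ∣ ∁ D ∣                      ≤⟨ ℕ.*-monoʳ-≤ 2 (∣∁p∣≤∣∁[p∪q]∣+∣q∩∁p∣ D A) ⟩
      2 * (∣ ∁ (D ∪ A) ∣ + ∣ A ∩ ∁ D ∣) ≤⟨ ℕ.*-monoʳ-≤ 2 (ℕ.+-monoʳ-≤ ∣ ∁ (D ∪ A) ∣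
                                            (ℕ.≤-trans (∣p∩q∣≤∣p∣ A (∁ D)) (∣N[v]∣≤1+maxDegree G v))) ⟩
      2 * (∣ ∁ (D ∪ A) ∣ + (1 + Δ))    ≡⟨ ℕ.*-distribˡ-+ 2 ∣ ∁ (D ∪ A) ∣ (1 + Δ) ⟩
      2 * ∣ ∁ (D ∪ A) ∣ + 2 * (1 + Δ)  ≤⟨ ℕ.+-monoˡ-≤ (2 * (1 + Δ)) (undominated≤movesLeft staller (D ∪ A) (rs (legal⇒⊂ G legal))) ⟩
      k * c + 4 + 2 * (1 + Δ)          ≡⟨ rearrange k Δ ⟩
      ℕ.suc k * c + c                  ∎
      where
      open ℕ.≤-Reasoning
      A = N[_] G v
      Δ = maxDegree G
      k = movesLeft G staller (D ∪ A) (rs (legal⇒⊂ G legal))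
      rearrange : ∀ k Δ → k * (3 + Δ) + 4 + 2 * (1 + Δ) ≡ ℕ.suc k * (3 + Δ) + (3 + Δ)
      rearrange = solve-∀
  undominated≤movesLeft staller D (acc rs) | yes nonempty
    -- Staller plays a leaf `u` of the forest induced by the undominated vertices; being
    -- undominated, `u` is legal.
    with u , u∈∁D , ≤1 ← acyclic⇒leaf G acyclic (∁ D) nonempty
    with (_ , legal) , m∈ , refl ← find (legal⇒∈legalMoves G (u , v∈N[v] G u , x∈∁p⇒x∉p u∈∁D)) = begin
      2 * ∣ ∁ D ∣                      ≤⟨ ℕ.*-monoʳ-≤ 2 (∣∁p∣≤∣∁[p∪q]∣+∣q∩∁p∣ D A) ⟩
      2 * (∣ ∁ (D ∪ A) ∣ + ∣ A ∩ ∁ D ∣) ≤⟨ ℕ.*-monoʳ-≤ 2 (ℕ.+-monoʳ-≤ ∣ ∁ (D ∪ A) ∣ (leaf⇒∣N[u]∩U∣≤2 G ≤1)) ⟩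
      2 * (∣ ∁ (D ∪ A) ∣ + 2)          ≡⟨ ℕ.*-distribˡ-+ 2 ∣ ∁ (D ∪ A) ∣ 2 ⟩
      2 * ∣ ∁ (D ∪ A) ∣ + 4            ≤⟨ ℕ.+-monoˡ-≤ 4 (undominated≤movesLeft dominator (D ∪ A) (rs (legal⇒⊂ G legal))) ⟩
      k * c + c + 4                    ≡⟨ cong (_+ 4) (ℕ.+-comm (k * c) c) ⟩
      ℕ.suc k * c + 4                  ≤⟨ ℕ.+-monoˡ-≤ 4 (ℕ.*-monoˡ-≤ c (≤optimum-staller (∈-map⁺ _ m∈))) ⟩
      movesLeft G staller D (acc rs) * c + 4 ∎
      where
      open ℕ.≤-Reasoning
      A = N[_] G u
      k = movesLeft G dominator (D ∪ A) (rs (legal⇒⊂ G legal))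

-- Passing to the ceiling.

i≤q*d⇒⌈i/d⌉≤q : ∀ i q d .{{_ : NonZero d}} → i ≤ q ℤ.* + d → ceiling (i / d) ≤ q
i≤q*d⇒⌈i/d⌉≤q i q d@(ℕ.suc _) i≤q*d =
  -- `ceiling` is the negated floor of the negated fraction, so it computes to `- f` here.
  subst (- f ≤_) (ℤ.neg-involutive q) (ℤ.neg-mono-≤ -q≤f)
  where
  f = (- i) ℤ./ + d
  open ℤ.≤-Reasoning
  -- As `f` is a floor, `- i` lies strictly below `(1 + f) * d`; cancelling `d` then gives
  -- `- q < 1 + f`.
  -q*d<[1+f]*d : (- q) ℤ.* + d ℤ.< ℤ.suc f ℤ.* + d
  -q*d<[1+f]*d = begin-strict
    (- q) ℤ.* + d                ≡⟨ ℤ.neg-distribˡ-* q (+ d) ⟨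
    - (q ℤ.* + d)                ≤⟨ ℤ.neg-mono-≤ i≤q*d ⟩
    - i                          <⟨ ℤ.n<s[n/ℕd]*d (- i) d ⟩
    ℤ.suc ((- i) ℤ./ℕ d) ℤ.* + d ≡⟨ cong (λ j → ℤ.suc j ℤ.* + d) (ℤ.div-pos-is-/ℕ (- i) d) ⟨
    ℤ.suc f ℤ.* + d              ∎
  -q≤f : - q ≤ f
  -q≤f = subst (- q ≤_) (ℤ.pred-suc f)
    (ℤ.i<j⇒i≤pred[j] (ℤ.*-cancelʳ-<-nonNeg { - q} {ℤ.suc f} (+ d) -q*d<[1+f]*d))

theorem2p2 : (n : ℕ) .{{_ : NonZero n}} (T : Graph n) → IsTree T →
    ceiling (+ (2 * n) / (3 + maxDegree T)) - 1ℤ ≤ + γg T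
theorem2p2 n T isTree = begin
  ceiling (+ (2 * n) / c) - 1ℤ ≤⟨ ℤ.+-monoˡ-≤ (- 1ℤ) (i≤q*d⇒⌈i/d⌉≤q _ (+ ℕ.suc (γg T)) c 2n≤[1+γg]*c) ⟩
  + ℕ.suc (γg T) - 1ℤ          ≡⟨⟩
  + γg T                       ∎
  where
  open ℤ.≤-Reasoning
  c = 3 + maxDegree T
  ∣∁⊥∣≡n : ∣ ∁ {n} ⊥ ∣ ≡ n
  ∣∁⊥∣≡n = trans (∣∁p∣≡n∸∣p∣ {n} ⊥) (cong (n ℕ.∸_) (∣⊥∣≡0 n))
  -- Dominator's slack `c` counts as one extra move, which is the 1 subtracted in the theorem.
  2n≤[1+γg]*c : + (2 * n) ≤ + ℕ.suc (γg T) ℤ.* + c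
  2n≤[1+γg]*c = begin
    + (2 * n)                ≡⟨ cong (λ k → + (2 * k)) ∣∁⊥∣≡n ⟨
    + (2 * ∣ ∁ {n} ⊥ ∣)      ≤⟨ ℤ.+≤+ (undominated≤movesLeft T (IsTree.acyclic isTree) dominator ⊥ (⊃-wellFounded ⊥)) ⟩
    + (γg T * c + c)         ≡⟨ cong +_ (ℕ.+-comm (γg T * c) c) ⟩
    + (ℕ.suc (γg T) * c)     ≡⟨ ℤ.pos-* (ℕ.suc (γg T)) c ⟩
    + ℕ.suc (γg T) ℤ.* + c   ∎
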